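{- Let $D_0$ be a two-row diagram whose nonempty rows are $r_1<r_2$. Then $\mathcal{P}(D_0)$ is ranked if and only if either (a) $r_1=1$, or (b) $r_1>1$, $\mathrm{Col}^{\rightarrow}(D_0;r_1)\cup\mathrm{Col}^{\rightarrow}(D_0;r_2)=\emptyset$, and $|\mathrm{Col}(D_0;r_1,r_2)|\le 1$. Moreover, in that case a rank function is given by $rk(D)=rowsum(D)-b(D_0)$ for $D\in KD(D_0)$.
   Context: A diagram is a finite set $D$ of cells $(r,c)$ with $r,c$ positive integers; $r$ is the row (rows numbered from bottom to top starting at 1) and $c$ the column (numbered from left to right starting at 1). A Kohnert move at row $r$ applied to a diagram $D$: if row $r$ of $D$ is empty, $D$ is unchanged; otherwise let $(r,c)$ be the cell of row $r$ with the largest column index; if every position $(r',c)$ with $1\le r'<r$ belongs to $D$, then $D$ is unchanged; otherwise let $r'$ be the largest integer with $1\le r'<r$ and $(r',c)\notin D$, and the move replaces the cell $(r,c)$ by $(r',c)$. For a diagram $D_0$, $KD(D_0)$ is the set of all diagrams obtainable from $D_0$ by finite (possibly empty) sequences of Kohnert moves; the Kohnert poset $\mathcal{P}(D_0)$ is $KD(D_0)$ ordered by $D_2\preceq D_1$ iff $D_2$ can be obtained from $D_1$ by a finite sequence of Kohnert moves; $Min(D_0)$ is its set of minimal elements. $rowsum(D)=\sum_{(r,c)\in D}r$ and $b(D_0)=\min\{rowsum(T):T\in Min(D_0)\}$. A finite poset $P$ is ranked if there is a function $\rho:P\to\mathbb{Z}_{\ge0}$ such that $x\prec y$ implies $\rho(x)<\rho(y)$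 and $\rho(y)=\rho(x)+1$ whenever $y$ covers $x$. A two-row diagram is a diagram with exactly two nonempty rows (not necessarily consecutive). For such $D_0$ with nonempty rows $r_1<r_2$: $\mathrm{Col}(D_0;r_1,r_2)$ is the set of columns containing cells in both rows; for $i=1,2$, $\mathrm{Col}(D_0;r_i)$ is the set of columns containing a cell only in row $r_i$, and $\mathrm{Col}^{\rightarrow}(D_0;r_i)=\{c\in\mathrm{Col}(D_0;r_i): c>\max\mathrm{Col}(D_0;r_1,r_2)\}$, taken to be empty when $\mathrm{Col}(D_0;r_1,r_2)=\emptyset$. -}

module Defs where

open import Data.Nat using (ℕ; zero; suc; _+_; _∸_; _≤_; _<_; _≤?_)
open import Data.Nat.Properties using () renaming (_≟_ to _≟ℕ_)
open import Data.Product using (Σ; ∃; ∃-syntax; _×_; _,_; proj₁; proj₂)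
open import Data.Product.Properties using (≡-dec)
open import Data.Sum using (_⊎_)
open import Data.Maybe using (Maybe; just; nothing)
open import Data.List using (List; []; _∷_; map; filter; deduplicate)
open import Data.Nat.ListAction using (sum)
open import Data.List.Relation.Unary.All using (All)
open import Data.List.Membership.Propositional using (_∈_; _∉_)
open import Data.List.Membership.DecPropositional (≡-dec _≟ℕ_ _≟ℕ_) using (_∈?_)
open import Relation.Nullary using (¬_; ¬?; yes; no; Dec)
open import Data.Empty using (⊥)
open import Relation.Binary.PropositionalEquality using (_≡_)
open import Relation.Binary.Construct.Closure.ReflexiveTransitive using (Star)

-- A cell (r , c): r = row (from bottom, starting at 1), c = column.
Cell : Set
Cell = ℕ × ℕ

-- A diagram is a finite set of cells, represented by a list; two lists
-- represent the same diagram iff they have the same members (_≈_ below).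
Diagram : Set
Diagram = List Cell

IsDiagram : Diagram → Set
IsDiagram D = All (λ x → 1 ≤ proj₁ x × 1 ≤ proj₂ x) D

_≈_ : Diagram → Diagram → Set
D ≈ E = ∀ x → (x ∈ D → x ∈ E) × (x ∈ E → x ∈ D)

_∈D?_ : (x : Cell) (D : Diagram) → Dec (x ∈ D)
x ∈D? D = x ∈? D

rowCols : ℕ → Diagram → List ℕ
rowCols r D = map proj₂ (filter (λ x → proj₁ x ≟ℕ r) D)

maxList : List ℕ → Maybe ℕ
maxList [] = nothing
maxList (x ∷ xs) with maxList xs
... | nothing = just x
... | just m with x ≤? m
...   | yes _ = just m
...   | no _ = just x

findFree : Diagram → ℕ → ℕ → Maybe ℕ
findFree D c zero = nothing
findFree D c (suc k) with (suc k , c) ∈D? D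
... | yes _ = findFree D c k
... | no _ = just (suc k)

move : ℕ → Diagram → Diagram
move r D with maxList (rowCols r D)
... | nothing = D
... | just c with findFree D c (r ∸ 1)
...   | nothing = D
...   | just r' = (r' , c) ∷ filter (λ x → ¬? (≡-dec _≟ℕ_ _≟ℕ_ x (r , c))) D

Step : Diagram → Diagram → Set
Step D E = ∃[ r ] (E ≡ move r D)

Reach : Diagram → Diagram → Set
Reach = Star Step

InKD : Diagram → Diagram → Set
InKD D0 D = ∃[ E ] (Reach D0 E × D ≈ E)

_⪯_ : Diagram → Diagram → Set
D2 ⪯ D1 = ∃[ E ] (Reach D1 E × D2 ≈ E)

_≺_ : Diagram → Diagram → Set
x ≺ y = x ⪯ y × ¬ (x ≈ y)

Covers : Diagram → Diagram → Diagram → Set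
Covers D0 x y = x ≺ y × (∀ z → InKD D0 z → x ≺ z → z ≺ y → ⊥)

-- ρ is a rank function on P(D0) (values in ℕ; must be well defined on
-- the set-level diagrams, i.e. respect _≈_).
IsRankFunction : Diagram → (Diagram → ℕ) → Set
IsRankFunction D0 ρ =
  (∀ x y → InKD D0 x → InKD D0 y → x ≈ y → ρ x ≡ ρ y) ×
  (∀ x y → InKD D0 x → InKD D0 y → x ≺ y → ρ x < ρ y) ×
  (∀ x y → InKD D0 x → InKD D0 y → Covers D0 x y → ρ y ≡ suc (ρ x))

Ranked : Diagram → Set
Ranked D0 = ∃[ ρ ] IsRankFunction D0 ρ

IsMin : Diagram → Diagram → Set
IsMin D0 T = InKD D0 T × (∀ D → InKD D0 D → D ⪯ T → D ≈ T)

rowsum : Diagram → ℕ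
rowsum D = sum (map proj₁ (deduplicate (≡-dec _≟ℕ_ _≟ℕ_) D))

IsB : Diagram → ℕ → Set
IsB D0 b = (∃[ T ] (IsMin D0 T × rowsum T ≡ b)) × (∀ T → IsMin D0 T → b ≤ rowsum T)

TwoRow : Diagram → ℕ → ℕ → Set
TwoRow D0 r1 r2 =
  IsDiagram D0 × r1 < r2 ×
  (∃[ c ] ((r1 , c) ∈ D0)) × (∃[ c ] ((r2 , c) ∈ D0)) ×
  (∀ r c → (r , c) ∈ D0 → r ≡ r1 ⊎ r ≡ r2)

InColBoth : Diagram → ℕ → ℕ → ℕ → Set
InColBoth D0 r1 r2 c = (r1 , c) ∈ D0 × (r2 , c) ∈ D0

InColOnly : Diagram → ℕ → ℕ → ℕ → Set
InColOnly D0 ri rj c = (ri , c) ∈ D0 × (rj , c) ∉ D0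

InColRight : Diagram → ℕ → ℕ → ℕ → ℕ → ℕ → Set
InColRight D0 r1 r2 ri rj c =
  InColOnly D0 ri rj c ×
  (∃[ m ] InColBoth D0 r1 r2 m) ×
  (∀ m → InColBoth D0 r1 r2 m → m < c)

{-# OPTIONS --safe #-}

-- Every Kohnert move lowers the row sum, and a move by one row is a cover, so only the
-- moves that jump over cells matter: the poset is graded by the row sum as soon as no
-- jump is a cover.
--
-- Under (a) or (b) this holds because a column either has at most one cell outside row 1
-- (no jump is possible) or has two cells and is the last column of the diagram; in the
-- latter case a jump is the composite of two unit moves, the lower cell going first.
--
-- Conversely let m be a common column with a cell in some column c > m, and r₁ > 1.
-- Unit moves bring the cells of row r₂ in the columns ≥ m down to row r₁ + 1. Then the
-- two cells of column m can be lowered by unit moves only, or, at a moment when row r₁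
-- still has a cell right of m, by the jump of the upper one. Such a cell blocks the
-- lower cell of column m, so this jump is a cover. Two saturated chains of different
-- lengths with the same end points result.

module Submission where

open import Defs
open import Data.Nat using (ℕ; zero; suc; _+_; _∸_; _≤_; _<_; z≤n; s≤s; s≤s⁻¹; _≤?_)
open import Data.Nat.Induction using (<-wellFounded)
open import Data.Nat.ListAction using (sum)
open import Data.Nat.ListAction.Properties using (sum-↭)
open import Data.Nat.Properties
open import Data.Nat.Solver using (module +-*-Solver)
open import Data.Empty using (⊥; ⊥-elim)
open import Data.List using (List; []; _∷_; map; filter; deduplicate)
open import Data.List.Membership.Propositional using (_∈_; _∉_)
open import Data.List.Membership.Propositional.Properties
  using (∈-filter⁺; ∈-filter⁻; ∈-map⁺; ∈-map⁻; ∈-deduplicate⁺; ∈-deduplicate⁻)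
open import Data.List.Membership.Propositional.Properties.WithK using (unique∧set⇒bag)
open import Data.List.Relation.Binary.BagAndSetEquality using (∼bag⇒↭)
import Data.List.Relation.Binary.Permutation.Propositional.Properties as ↭
import Data.List.Relation.Unary.All as All
import Data.List.Relation.Unary.AllPairs as AllPairs
open import Data.List.Relation.Unary.Any using (here; there)
open import Data.List.Relation.Unary.Unique.Propositional using (Unique)
open import Data.List.Relation.Unary.Unique.Propositional.Properties using (filter⁺)
open import Data.Maybe using (just; nothing)
open import Data.Product using (∃-syntax; _×_; _,_; proj₁; proj₂)
open import Data.Product.Properties using (≡-dec)
open import Data.Sum using (_⊎_; inj₁; inj₂; [_,_]′)
open import Function using (_∘_)
open import Function.Bundles using (_⇔_; mk⇔)
open import Induction.WellFounded using (Acc; acc)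
open import Relation.Binary.Construct.Closure.ReflexiveTransitive using (Star; ε; _◅_; _◅◅_)
open import Relation.Binary.Definitions using (DecidableEquality; tri<; tri≈; tri>)
open import Relation.Binary.PropositionalEquality
  using (_≡_; _≢_; refl; sym; trans; cong; cong₂; subst; subst₂; module ≡-Reasoning)
open import Relation.Nullary using (¬_; ¬?; yes; no; Dec)

-- Diagrams up to set equality

_≟ᶜ_ : DecidableEquality Cell
_≟ᶜ_ = ≡-dec _≟_ _≟_

open import Data.List.Relation.Unary.Unique.DecPropositional.Properties _≟ᶜ_ using (deduplicate-!)

≈-refl : ∀ {D} → D ≈ D
≈-refl x = (λ p → p) , (λ p → p)

≈-sym : ∀ {D E} → D ≈ E → E ≈ D
≈-sym e x = proj₂ (e x) , proj₁ (e x)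

≈-trans : ∀ {D E F} → D ≈ E → E ≈ F → D ≈ F
≈-trans e f x = (λ p → proj₁ (f x) (proj₁ (e x) p)) , (λ p → proj₂ (e x) (proj₂ (f x) p))

≈⇒⊆ : ∀ {D E x} → D ≈ E → x ∈ D → x ∈ E
≈⇒⊆ e = proj₁ (e _)

≈⇒⊇ : ∀ {D E x} → D ≈ E → x ∈ E → x ∈ D
≈⇒⊇ e = proj₂ (e _)

-- Kohnert moves

-- The Kohnert moves that change the diagram, with both diagrams taken up to ≈.
record Drop (D E : Diagram) (r c r′ : ℕ) : Set where
  field
    cell      : (r , c) ∈ D
    rightmost : ∀ {c′} → c < c′ → (r , c′) ∉ D
    positive  : 1 ≤ r′
    below     : r′ < r
    free      : (r′ , c) ∉ D
    full      : ∀ {k} → r′ < k → k < r → (k , c) ∈ D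
    into      : ∀ {x} → x ∈ E → x ≡ (r′ , c) ⊎ (x ∈ D × x ≢ (r , c))
    landed    : (r′ , c) ∈ E
    kept      : ∀ {x} → x ∈ D → x ≢ (r , c) → x ∈ E

open Drop

Drop-resp : ∀ {D D′ E E′ r c r′} → D ≈ D′ → E ≈ E′ → Drop D E r c r′ → Drop D′ E′ r c r′
Drop-resp {D} {D′} {E} {E′} {r} {c} {r′} d e p = record
  { cell      = ≈⇒⊆ d (cell p)
  ; rightmost = λ lt q → rightmost p lt (≈⇒⊇ d q)
  ; positive  = positive p
  ; below     = below p
  ; free      = λ q → free p (≈⇒⊇ d q)
  ; full      = λ a b → ≈⇒⊆ d (full p a b)
  ; into      = into′
  ; landed    = ≈⇒⊆ e (landed p)
  ; kept      = λ q n → ≈⇒⊆ e (kept p (≈⇒⊇ d q) n)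
  }
  where
  into′ : ∀ {x} → x ∈ E′ → x ≡ (r′ , c) ⊎ (x ∈ D′ × x ≢ (r , c))
  into′ q with into p (≈⇒⊇ e q)
  ... | inj₁ eq      = inj₁ eq
  ... | inj₂ (i , n) = inj₂ (≈⇒⊆ d i , n)

relocate : Cell → Cell → Diagram → Diagram
relocate x y D = y ∷ filter (λ z → ¬? (z ≟ᶜ x)) D

relocate-into : ∀ {x y z D} → z ∈ relocate x y D → z ≡ y ⊎ (z ∈ D × z ≢ x)
relocate-into (here eq) = inj₁ eq
relocate-into {x} {D = D} (there q) = inj₂ (∈-filter⁻ (λ z → ¬? (z ≟ᶜ x)) {xs = D} q)

relocate-kept : ∀ {x y z D} → z ∈ D → z ≢ x → z ∈ relocate x y D
relocate-kept {x} q n = there (∈-filter⁺ (λ z → ¬? (z ≟ᶜ x)) q n)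

relocate-Drop : ∀ {D r c r′} → (r , c) ∈ D → (∀ {c′} → c < c′ → (r , c′) ∉ D) →
  1 ≤ r′ → r′ < r → (r′ , c) ∉ D → (∀ {k} → r′ < k → k < r → (k , c) ∈ D) →
  Drop D (relocate (r , c) (r′ , c) D) r c r′
relocate-Drop i rm pos lt fr fu = record
  { cell = i ; rightmost = rm ; positive = pos ; below = lt ; free = fr ; full = fu
  ; into = relocate-into ; landed = here refl ; kept = relocate-kept }

∈-rowCols⁺ : ∀ {r c D} → (r , c) ∈ D → c ∈ rowCols r D
∈-rowCols⁺ {r} {c} {D} p = ∈-map⁺ proj₂ (∈-filter⁺ (λ x → proj₁ x ≟ r) p refl)

∈-rowCols⁻ : ∀ {r c D} → c ∈ rowCols r D → (r , c) ∈ D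
∈-rowCols⁻ {r} {D = D} p with ∈-map⁻ proj₂ p
... | (a , b) , q , refl with ∈-filter⁻ (λ x → proj₁ x ≟ r) {xs = D} q
... | i , refl = i

maxList-nothing : ∀ xs → maxList xs ≡ nothing → xs ≡ []
maxList-nothing [] eq = refl
maxList-nothing (x ∷ xs) eq with maxList xs
maxList-nothing (x ∷ xs) () | nothing
... | just m with x ≤? m
maxList-nothing (x ∷ xs) () | just m | yes _
maxList-nothing (x ∷ xs) () | just m | no _

maxList-just : ∀ xs {m} → maxList xs ≡ just m → m ∈ xs × (∀ {y} → y ∈ xs → y ≤ m)
maxList-just (x ∷ xs) eq with maxList xs in eq′
maxList-just (x ∷ xs) refl | nothing rewrite maxList-nothing xs eq′ =
  here refl , λ { (here refl) → ≤-refl }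
maxList-just (x ∷ xs) eq | just m with x ≤? m
maxList-just (x ∷ xs) refl | just m | yes p with maxList-just xs eq′
... | i , b = there i , λ { (here refl) → p ; (there q) → b q }
maxList-just (x ∷ xs) refl | just m | no ¬p with maxList-just xs eq′
... | i , b = here refl , λ { (here refl) → ≤-refl ; (there q) → ≤-trans (b q) (≰⇒≥ ¬p) }

findFree-nothing : ∀ D c k → findFree D c k ≡ nothing → ∀ {j} → 1 ≤ j → j ≤ k → (j , c) ∈ D
findFree-nothing D c zero eq 1≤j j≤k = ⊥-elim (<⇒≱ 1≤j j≤k)
findFree-nothing D c (suc k) eq 1≤j j≤k with (suc k , c) ∈D? D
findFree-nothing D c (suc k) () 1≤j j≤k | no _
... | yes p with m≤n⇒m<n∨m≡n j≤k
... | inj₁ (s≤s j≤k′) = findFree-nothing D c k eq 1≤j j≤k′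
... | inj₂ refl = p

findFree-just : ∀ D c k {t} → findFree D c k ≡ just t →
  1 ≤ t × t ≤ k × (t , c) ∉ D × (∀ {j} → t < j → j ≤ k → (j , c) ∈ D)
findFree-just D c (suc k) eq with (suc k , c) ∈D? D
findFree-just D c (suc k) refl | no n = s≤s z≤n , ≤-refl , n , λ lt le → ⊥-elim (<⇒≱ lt le)
... | yes p with findFree-just D c k eq
... | pos , le , fr , fu = pos , m≤n⇒m≤1+n le , fr , fu′
  where
  fu′ : ∀ {j} → _ < j → j ≤ suc k → (j , c) ∈ D
  fu′ lt le′ with m≤n⇒m<n∨m≡n le′
  ... | inj₁ (s≤s le″) = fu lt le″
  ... | inj₂ refl = p

-- Replaces the computation of `move` by `Drop`. The idle case excludes drops from row `r` to every
-- target, so drops and effective moves coincide.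
move-cases : ∀ r D → (move r D ≡ D × (∀ {E c r′} → ¬ Drop D E r c r′)) ⊎
                     (∃[ c ] ∃[ r′ ] Drop D (move r D) r c r′)
move-cases r D with maxList (rowCols r D) in eq
... | nothing = inj₁ (refl , λ p → ¬empty (maxList-nothing _ eq) (∈-rowCols⁺ (cell p)))
  where
  ¬empty : ∀ {xs : List ℕ} {y} → xs ≡ [] → y ∉ xs
  ¬empty refl ()
... | just c with maxList-just _ eq
... | i , b with findFree D c (r ∸ 1) in eq′
... | nothing = inj₁ (refl , λ p → stuck p (column p))
  where
  column : ∀ {E d r′} → Drop D E r d r′ → d ≡ c
  column p with <-cmp _ c
  ... | tri< lt _ _ = ⊥-elim (rightmost p lt (∈-rowCols⁻ i))
  ... | tri≈ _ e _  = e
  ... | tri> _ _ gt = ⊥-elim (<⇒≱ gt (b (∈-rowCols⁺ (cell p))))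
  stuck : ∀ {E d r′} → Drop D E r d r′ → d ≡ c → ⊥
  stuck p refl = free p (findFree-nothing D c (r ∸ 1) eq′ (positive p) (m<n⇒m≤n∸1 (below p)))
    where
    m<n⇒m≤n∸1 : ∀ {m n} → m < n → m ≤ n ∸ 1
    m<n⇒m≤n∸1 (s≤s le) = le
... | just t with findFree-just D c (r ∸ 1) eq′
... | pos , le , fr , fu = inj₂ (c , t , relocate-Drop (∈-rowCols⁻ i)
        (λ lt q → <⇒≱ lt (b (∈-rowCols⁺ q))) pos
        (≤∸1 r pos le) fr λ lt lt′ → fu lt (<∸1 r lt′))
  where
  -- For `n` zero the subtraction truncates; `1 ≤ m` excludes that case.
  ≤∸1 : ∀ n {m} → 1 ≤ m → m ≤ n ∸ 1 → m < n
  ≤∸1 zero (s≤s _) ()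
  ≤∸1 (suc n) _ le = s≤s le
  <∸1 : ∀ n {m} → m < n → m ≤ n ∸ 1
  <∸1 (suc n) (s≤s le) = le

-- `rightmost` fixes the column. If the landing rows differed, the higher one would be free for its
-- own drop and occupied for the other.
Drop-det : ∀ {D E F r c d r′ t} → Drop D E r c r′ → Drop D F r d t →
  c ≡ d × r′ ≡ t × E ≈ F
Drop-det {D} {E} {F} {r} {c} {d} {r′} {t} p q with <-cmp c d
... | tri< lt _ _ = ⊥-elim (rightmost p lt (cell q))
... | tri> _ _ gt = ⊥-elim (rightmost q gt (cell p))
... | tri≈ _ refl _ with <-cmp r′ t
... | tri< lt _ _ = ⊥-elim (free q (full p lt (below q)))
... | tri> _ _ gt = ⊥-elim (free p (full q gt (below p)))
... | tri≈ _ refl _ = refl , refl , λ x → half p q , half q p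
  where
  half : ∀ {E F x} → Drop D E r c r′ → Drop D F r c r′ → x ∈ E → x ∈ F
  half p q i with into p i
  ... | inj₁ refl    = landed q
  ... | inj₂ (j , n) = kept q j n

Drop⇒move : ∀ {D E r c r′} → Drop D E r c r′ → move r D ≈ E
Drop⇒move {D} {r = r} p with move-cases r D
... | inj₁ (_ , stuck)   = ⊥-elim (stuck p)
... | inj₂ (_ , _ , q) = proj₂ (proj₂ (Drop-det q p))

⪯-refl : ∀ {D E} → D ≈ E → D ⪯ E
⪯-refl e = _ , ε , e

-- `Step` asks for the very list `move r D`, so the effective moves of a path are replayed from `D′`
-- and the end is recovered only up to `≈`.
Reach-resp : ∀ {D D′ E} → D ≈ D′ → Reach D E → E ⪯ D′
Reach-resp e ε = _ , ε , e
Reach-resp {D} {D′} e ((r , refl) ◅ s) with move-cases r D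
... | inj₁ (eq , _) rewrite eq = Reach-resp e s
... | inj₂ (_ , _ , p) with Reach-resp (≈-sym (Drop⇒move (Drop-resp e ≈-refl p))) s
... | F , s′ , e′ = F , (r , refl) ◅ s′ , e′

⪯-trans : ∀ {x y z} → x ⪯ y → y ⪯ z → x ⪯ z
⪯-trans (E , s , e) (F , t , f) with Reach-resp f s
... | G , u , g = G , t ◅◅ u , ≈-trans e g

⪯-extend : ∀ {x y z r c r′} → x ⪯ y → Drop z y r c r′ → x ⪯ z
⪯-extend x⪯y p = ⪯-trans x⪯y (_ , (_ , refl) ◅ ε , ≈-sym (Drop⇒move p))

Drop⇒⪯ : ∀ {x y r c r′} → Drop y x r c r′ → x ⪯ y
Drop⇒⪯ p = ⪯-extend (⪯-refl ≈-refl) p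

Reach-first : ∀ {y E} → Reach y E →
  E ≡ y ⊎ (∃[ z ] ∃[ r ] ∃[ c ] ∃[ r′ ] (Drop y z r c r′ × Reach z E))
Reach-first ε = inj₁ refl
Reach-first {y} ((r , refl) ◅ s) with move-cases r y
... | inj₁ (eq , _) rewrite eq = Reach-first s
... | inj₂ (c , r′ , p) = inj₂ (_ , r , c , r′ , p , s)

⪯-first : ∀ {x y} → x ⪯ y → x ≈ y ⊎ (∃[ z ] ∃[ r ] ∃[ c ] ∃[ r′ ] (Drop y z r c r′ × x ⪯ z))
⪯-first (E , s , e) with Reach-first s
... | inj₁ refl                         = inj₁ e
... | inj₂ (z , r , c , r′ , p , s′) = inj₂ (z , r , c , r′ , p , (E , s′ , e))

-- Invariants pass down the order: idle moves change nothing, so only drops and changes of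
-- representative need checking.
⪯-ind : ∀ (P : Diagram → Set) → (∀ {D E} → D ≈ E → P D → P E) →
  (∀ {D E r c r′} → Drop D E r c r′ → P D → P E) → ∀ {x y} → x ⪯ y → P y → P x
⪯-ind P resp step (_ , s , e) base = resp (≈-sym e) (along s base)
  where
  along : ∀ {D E} → Reach D E → P D → P E
  along ε p = p
  along {D} ((r , refl) ◅ s) p with move-cases r D
  ... | inj₁ (eq , _) rewrite eq = along s p
  ... | inj₂ (_ , _ , d) = along s (step d p)

-- Weights and row sums

-- `rowsum` is the case `proj₁`; a general `f` also covers the column counts that detect covering
-- jumps.
weight : (Cell → ℕ) → Diagram → ℕ
weight f D = sum (map f (deduplicate _≟ᶜ_ D))

sum-unique : ∀ f {xs ys : List Cell} → Unique xs → Unique ys → xs ≈ ys → sum (map f xs) ≡ sum (map f ys)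
sum-unique f u v e =
  sum-↭ (↭.map⁺ f (∼bag⇒↭ (unique∧set⇒bag u v (λ {x} → mk⇔ (proj₁ (e x)) (proj₂ (e x))))))

dedup-≈ : ∀ D → deduplicate _≟ᶜ_ D ≈ D
dedup-≈ D x = ∈-deduplicate⁻ _≟ᶜ_ D , ∈-deduplicate⁺ _≟ᶜ_

weight-resp : ∀ f {D E} → D ≈ E → weight f D ≡ weight f E
weight-resp f {D} {E} e = sum-unique f (deduplicate-! D) (deduplicate-! E)
  (≈-trans (dedup-≈ D) (≈-trans e (≈-sym (dedup-≈ E))))

-- `w` is the weight of the cells that stay in place; naming it avoids subtraction.
weight-Drop : ∀ f {D E r c r′} → Drop D E r c r′ → ∃[ w ]
  (weight f D ≡ f (r , c) + w × weight f E ≡ f (r′ , c) + w)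
weight-Drop f {D} {E} {r} {c} {r′} p = sum (map f U) ,
    sum-unique f (deduplicate-! D) (unique (r , c) λ i → proj₂ (rest i) refl) eqD ,
    sum-unique f (deduplicate-! E) (unique (r′ , c) λ i → free p (proj₁ (rest i))) eqE
  where
  P? : ∀ z → Dec (z ≢ (r , c))
  P? z = ¬? (z ≟ᶜ (r , c))
  U : Diagram
  U = filter P? (deduplicate _≟ᶜ_ D)
  unique : ∀ x → x ∉ U → Unique (x ∷ U)
  unique x n = All.tabulate (λ i eq → n (subst (_∈ U) (sym eq) i)) AllPairs.∷ filter⁺ P? (deduplicate-! D)
  rest : ∀ {z} → z ∈ U → z ∈ D × z ≢ (r , c)
  rest i with ∈-filter⁻ P? {xs = deduplicate _≟ᶜ_ D} i
  ... | j , n = ≈⇒⊆ (dedup-≈ D) j , n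
  inU : ∀ {z} → z ∈ D → z ≢ (r , c) → z ∈ U
  inU i n = ∈-filter⁺ P? (≈⇒⊇ (dedup-≈ D) i) n
  eqD : deduplicate _≟ᶜ_ D ≈ ((r , c) ∷ U)
  eqD x = f⁺ , f⁻
    where
    f⁺ : x ∈ deduplicate _≟ᶜ_ D → x ∈ ((r , c) ∷ U)
    f⁺ i with x ≟ᶜ (r , c)
    ... | yes eq = here eq
    ... | no n   = there (inU (≈⇒⊆ (dedup-≈ D) i) n)
    f⁻ : x ∈ ((r , c) ∷ U) → x ∈ deduplicate _≟ᶜ_ D
    f⁻ (here refl) = ≈⇒⊇ (dedup-≈ D) (cell p)
    f⁻ (there i)   = ≈⇒⊇ (dedup-≈ D) (proj₁ (rest i))
  eqE : deduplicate _≟ᶜ_ E ≈ ((r′ , c) ∷ U)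
  eqE x = f⁺ , f⁻
    where
    f⁺ : x ∈ deduplicate _≟ᶜ_ E → x ∈ ((r′ , c) ∷ U)
    f⁺ i with into p (≈⇒⊆ (dedup-≈ E) i)
    ... | inj₁ eq      = here eq
    ... | inj₂ (j , n) = there (inU j n)
    f⁻ : x ∈ ((r′ , c) ∷ U) → x ∈ deduplicate _≟ᶜ_ E
    f⁻ (here refl) = ≈⇒⊇ (dedup-≈ E) (landed p)
    f⁻ (there i)   = ≈⇒⊇ (dedup-≈ E) (kept p (proj₁ (rest i)) (proj₂ (rest i)))

weight-mono : ∀ f → (∀ {c i j} → i ≤ j → f (i , c) ≤ f (j , c)) →
  ∀ {x y} → x ⪯ y → weight f x ≤ weight f y
weight-mono f f-mono {x} {y} x⪯y =
  ⪯-ind (λ D → weight f D ≤ weight f y) ≈-case step x⪯y ≤-refl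
  where
  ≈-case : ∀ {D E} → D ≈ E → weight f D ≤ weight f y → weight f E ≤ weight f y
  ≈-case e le = subst (_≤ weight f y) (weight-resp f e) le
  step : ∀ {D E r c r′} → Drop D E r c r′ → weight f D ≤ weight f y → weight f E ≤ weight f y
  step p le with weight-Drop f p
  ... | w , eqD , eqE = ≤-trans (≤-reflexive eqE) (≤-trans (+-monoˡ-≤ w (f-mono (<⇒≤ (below p))))
                          (≤-trans (≤-reflexive (sym eqD)) le))

weight-Drop-< : ∀ f {D E r c r′} → f (r′ , c) < f (r , c) → Drop D E r c r′ → weight f E < weight f D
weight-Drop-< f lt p with weight-Drop f p
... | w , eqD , eqE = subst₂ _<_ (sym eqE) (sym eqD) (+-monoˡ-< w lt)

weight-Drop-≡ : ∀ f {D E r c r′} → f (r′ , c) ≡ f (r , c) → Drop D E r c r′ → weight f E ≡ weight f D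
weight-Drop-≡ f eq p with weight-Drop f p
... | w , eqD , eqE = trans eqE (trans (cong (_+ w) eq) (sym eqD))

rowsum-resp : ∀ {D E} → D ≈ E → rowsum D ≡ rowsum E
rowsum-resp = weight-resp proj₁

rowsum-mono : ∀ {x y} → x ⪯ y → rowsum x ≤ rowsum y
rowsum-mono = weight-mono proj₁ (λ le → le)

rowsum-Drop-< : ∀ {D E r c r′} → Drop D E r c r′ → rowsum E < rowsum D
rowsum-Drop-< p = weight-Drop-< proj₁ (below p) p

rowsum-Drop-+ : ∀ k {D E c r′} → Drop D E (k + r′) c r′ → rowsum D ≡ k + rowsum E
rowsum-Drop-+ k {r′ = r′} p with weight-Drop proj₁ p
... | w , eqD , eqE = trans eqD (trans (+-assoc k r′ w) (cong (k +_) (sym eqE)))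

Drop⇒≺ : ∀ {x y r c r′} → Drop y x r c r′ → x ≺ y
Drop⇒≺ p = Drop⇒⪯ p , λ e → <⇒≢ (rowsum-Drop-< p) (rowsum-resp e)

≺-first : ∀ {x y} → x ≺ y → ∃[ z ] ∃[ r ] ∃[ c ] ∃[ r′ ] (Drop y z r c r′ × x ⪯ z)
≺-first (x⪯y , x≉y) with ⪯-first x⪯y
... | inj₁ e = ⊥-elim (x≉y e)
... | inj₂ p = p

≺⇒rowsum-< : ∀ {x y} → x ≺ y → rowsum x < rowsum y
≺⇒rowsum-< x≺y with ≺-first x≺y
... | _ , _ , _ , _ , p , x⪯z = ≤-<-trans (rowsum-mono x⪯z) (rowsum-Drop-< p)

-- Minimal elements and the rank function

Terminal : Diagram → Set
Terminal T = ∀ {E r c r′} → ¬ Drop T E r c r′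

Terminal⇒IsMin : ∀ {D₀ T} → T ⪯ D₀ → Terminal T → IsMin D₀ T
Terminal⇒IsMin T⪯D₀ t = T⪯D₀ , λ D _ D⪯T → [ (λ e → e) , (λ (_ , _ , _ , _ , p , _) → ⊥-elim (t p)) ]′ (⪯-first D⪯T)

IsMin⇒Terminal : ∀ {D₀ T} → IsMin D₀ T → Terminal T
IsMin⇒Terminal (T⪯D₀ , min) p =
  proj₂ (Drop⇒≺ p) (min _ (⪯-trans (Drop⇒⪯ p) T⪯D₀) (Drop⇒⪯ p))

-- The lower bound is confined to first drops from rows in `L`, so that the rows can be searched one
-- at a time.
LeastVia : Diagram → List ℕ → ℕ → Set
LeastVia D L b =
  (∃[ T ] (T ⪯ D × Terminal T × rowsum T ≡ b)) ×
  (∀ {E r c r′} → r ∈ L → Drop D E r c r′ → ∀ T → T ⪯ E → Terminal T → b ≤ rowsum T)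

Least : Diagram → ℕ → Set
Least D b =
  (∃[ T ] (T ⪯ D × Terminal T × rowsum T ≡ b)) ×
  (∀ T → T ⪯ D → Terminal T → b ≤ rowsum T)

-- Recursion on the row sum, which every drop lowers.
least : ∀ D → ∃[ b ] Least D b
least D = go D (<-wellFounded (rowsum D))
  where
  ⪯-Drop : ∀ {D E F r c d r′ t T} → Drop D E r c r′ → Drop D F r d t → T ⪯ E → T ⪯ F
  ⪯-Drop p q T⪯E = ⪯-trans T⪯E (⪯-refl (proj₂ (proj₂ (Drop-det p q))))

  go : ∀ D → Acc _<_ (rowsum D) → ∃[ b ] Least D b
  -- Only a row that holds a cell can start a drop, so this list of rows is exhaustive.
  go D (acc rec) = conclude (via (map proj₁ D))
    where
    via : ∀ L → (∀ {E r c r′} → r ∈ L → ¬ Drop D E r c r′) ⊎ (∃[ b ] LeastVia D L b)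
    via [] = inj₁ λ ()
    via (r ∷ L) with move-cases r D | via L
    ... | inj₁ (_ , stuck) | inj₁ none = inj₁ λ { (here refl) p → stuck p ; (there i) p → none i p }
    ... | inj₁ (_ , stuck) | inj₂ (b , att , low) =
      inj₂ (b , att , λ { (here refl) p → ⊥-elim (stuck p) ; (there i) p → low i p })
    ... | inj₂ (_ , _ , q) | rest with go (move r D) (rec (rowsum-Drop-< q)) | rest
    ... | b , (T , T⪯ , t , eq) , low | inj₁ none =
      inj₂ (b , (T , ⪯-extend T⪯ q , t , eq) ,
        λ { (here refl) p S S⪯ s → low S (⪯-Drop p q S⪯) s
          ; (there i) p → ⊥-elim (none i p) })
    ... | b , (T , T⪯ , t , eq) , low | inj₂ (b′ , att , low′) with ≤-total b b′
    ... | inj₁ b≤b′ =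
      inj₂ (b , (T , ⪯-extend T⪯ q , t , eq) ,
        λ { (here refl) p S S⪯ s → low S (⪯-Drop p q S⪯) s
          ; (there i) p S S⪯ s → ≤-trans b≤b′ (low′ i p S S⪯ s) })
    ... | inj₂ b′≤b =
      inj₂ (b′ , att ,
        λ { (here refl) p S S⪯ s → ≤-trans b′≤b (low S (⪯-Drop p q S⪯) s)
          ; (there i) p S S⪯ s → low′ i p S S⪯ s })

    conclude : (∀ {E r c r′} → r ∈ map proj₁ D → ¬ Drop D E r c r′) ⊎
               (∃[ b ] LeastVia D (map proj₁ D) b) → ∃[ b ] Least D b
    conclude (inj₁ none) = rowsum D , (D , ⪯-refl ≈-refl , terminal , refl) , low
      where
      terminal : Terminal D
      terminal p = none (∈-map⁺ proj₁ (cell p)) p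
      low : ∀ T → T ⪯ D → Terminal T → rowsum D ≤ rowsum T
      low T T⪯D t with ⪯-first T⪯D
      ... | inj₁ e = ≤-reflexive (sym (rowsum-resp e))
      ... | inj₂ (_ , _ , _ , _ , p , _) = ⊥-elim (terminal p)
    conclude (inj₂ (b , (S , S⪯ , s , eq) , low)) = b , (S , S⪯ , s , eq) , low′
      where
      low′ : ∀ T → T ⪯ D → Terminal T → b ≤ rowsum T
      low′ T T⪯D t with ⪯-first T⪯D
      ... | inj₂ (_ , _ , _ , _ , p , T⪯) = low (∈-map⁺ proj₁ (cell p)) p T T⪯ t
      ... | inj₁ e = ≤-trans (subst (_≤ rowsum D) eq (rowsum-mono S⪯)) (≤-reflexive (sym (rowsum-resp e)))

-- A drop of one row is a cover; a longer one must never be.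
Graded : Diagram → Set
Graded D₀ = ∀ {D E r c r′} → D ⪯ D₀ → Drop D E r c r′ →
  r ≡ suc r′ ⊎ (∃[ z ] (E ≺ z × z ≺ D))

≺-resp : ∀ {x x′ y} → x ≈ x′ → x ≺ y → x′ ≺ y
≺-resp e (le , n) = ⪯-trans (⪯-refl (≈-sym e)) le , λ e′ → n (≈-trans e e′)

-- A cover is a single drop, since the result of a first drop followed by another would lie strictly
-- between. `Graded` leaves only drops of one row, which lower the row sum by one.
Graded⇒IsRankFunction : ∀ {D₀} → Graded D₀ →
  ∃[ b ] (IsB D₀ b × IsRankFunction D₀ (λ D → rowsum D ∸ b))
Graded⇒IsRankFunction {D₀} graded with least D₀
... | b , (T , T⪯ , t , eq) , low =
  b , ((T , Terminal⇒IsMin T⪯ t , eq) , λ S m → low S (proj₁ m) (IsMin⇒Terminal m)) ,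
  (λ x y _ _ e → cong (_∸ b) (rowsum-resp e)) ,
  (λ x y x∈ _ x≺y → ∸-monoˡ-< (≺⇒rowsum-< x≺y) (b≤ x∈)) ,
  (λ x y x∈ y∈ cov → trans (cong (_∸ b) (cover y∈ cov)) (+-∸-assoc 1 (b≤ x∈)))
  where
  -- Some terminal diagram lies below `x`, so no subtraction of `b` truncates.
  b≤ : ∀ {x} → x ⪯ D₀ → b ≤ rowsum x
  b≤ {x} x⪯D₀ with least x
  ... | _ , (S , S⪯ , s , _) , _ = ≤-trans (low S (⪯-trans S⪯ x⪯D₀) s) (rowsum-mono S⪯)
  cover : ∀ {x y} → y ⪯ D₀ → Covers D₀ x y → rowsum y ≡ suc (rowsum x)
  cover {x} {y} y⪯D₀ (x≺y , none) with ≺-first x≺y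
  ... | z , r , c , r′ , p , x⪯z with ⪯-first x⪯z
  ... | inj₂ (_ , _ , _ , _ , q , x⪯) = ⊥-elim
    (none z (⪯-trans (Drop⇒⪯ p) y⪯D₀)
      (x⪯z , λ e → <⇒≱ (≤-<-trans (rowsum-mono x⪯) (rowsum-Drop-< q)) (≤-reflexive (sym (rowsum-resp e))))
      (Drop⇒≺ p))
  ... | inj₁ e with graded y⪯D₀ p
  ... | inj₁ refl = trans (rowsum-Drop-+ 1 p) (cong suc (sym (rowsum-resp e)))
  ... | inj₂ (w , z≺w , w≺y) = ⊥-elim (none w (⪯-trans (proj₁ w≺y) y⪯D₀) (≺-resp (≈-sym e) z≺w) w≺y)

-- Diagrams graded by the row sum

Thin : Diagram → ℕ → Set
Thin D c = ∀ {i j} → (i , c) ∈ D → (j , c) ∈ D → i ≡ j ⊎ i ≡ 1 ⊎ j ≡ 1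

-- "At most two cells" is put as a coincidence among three, which pulls back along a drop without
-- counting. The second clause says that no cell lies right of column `c`.
Double : Diagram → ℕ → Set
Double D c = (∀ {i j k} → (i , c) ∈ D → (j , c) ∈ D → (k , c) ∈ D → i ≡ j ⊎ i ≡ k ⊎ j ≡ k) ×
             (∀ {i d} → (i , d) ∈ D → d ≤ c)

Tame : Diagram → Set
Tame D = ∀ c → Thin D c ⊎ Double D c

-- The cell (i , d) present after the drop of (r , c) to (r′ , c) stems from (i₀ , d).
data Trace (r c r′ d i : ℕ) : ℕ → Set where
  moved : d ≡ c → i ≡ r′ → Trace r c r′ d i r
  still : ∀ {i₀} → i ≡ i₀ → (d ≡ c → i ≢ r) → Trace r c r′ d i i₀

trace : ∀ {D E r c r′ i d} → Drop D E r c r′ → (i , d) ∈ E → ∃[ i₀ ] ((i₀ , d) ∈ D × Trace r c r′ d i i₀)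
trace p q with into p q
... | inj₁ refl    = _ , cell p , moved refl refl
... | inj₂ (q₀ , n) = _ , q₀ , still refl λ { refl refl → n refl }

-- An origin determines where its cell is now, because `still` excludes the one cell that moved.
Trace-injective : ∀ {r c r′ d i j i₀ j₀} → Trace r c r′ d i i₀ → Trace r c r′ d j j₀ → i₀ ≡ j₀ → i ≡ j
Trace-injective (moved _ refl) (moved _ refl) eq = refl
Trace-injective (moved d≡c _) (still refl n) eq = ⊥-elim (n d≡c (sym eq))
Trace-injective (still refl n) (moved d≡c _) eq = ⊥-elim (n d≡c eq)
Trace-injective (still refl _) (still refl _) eq = eq

Trace-bottom : ∀ {D E r c r′ d i i₀} → Drop D E r c r′ → Trace r c r′ d i i₀ → i₀ ≡ 1 → i ≡ 1
Trace-bottom p (moved _ _) refl = ⊥-elim (<⇒≱ (below p) (positive p))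
Trace-bottom p (still refl _) eq = eq

-- Both alternatives pass from origins to present cells: equal origins give equal rows, and a cell
-- of row 1 stays there.
Thin-Drop : ∀ {D E r c r′} → Drop D E r c r′ → ∀ {d} → Thin D d → Thin E d
Thin-Drop p thin i j with trace p i | trace p j
... | _ , i₀ , t | _ , j₀ , u with thin i₀ j₀
... | inj₁ eq        = inj₁ (Trace-injective t u eq)
... | inj₂ (inj₁ eq) = inj₂ (inj₁ (Trace-bottom p t eq))
... | inj₂ (inj₂ eq) = inj₂ (inj₂ (Trace-bottom p u eq))

Double-Drop : ∀ {D E r c r′} → Drop D E r c r′ → ∀ {d} → Double D d → Double E d
Double-Drop {D} {E} p {d} (two , right) = two′ , λ i → right (proj₁ (proj₂ (trace p i)))
  where
  two′ : ∀ {i j k} → (i , d) ∈ E → (j , d) ∈ E → (k , d) ∈ E → i ≡ j ⊎ i ≡ k ⊎ j ≡ k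
  two′ i j k with trace p i | trace p j | trace p k
  ... | _ , i₀ , t | _ , j₀ , u | _ , k₀ , v with two i₀ j₀ k₀
  ... | inj₁ eq        = inj₁ (Trace-injective t u eq)
  ... | inj₂ (inj₁ eq) = inj₂ (inj₁ (Trace-injective t v eq))
  ... | inj₂ (inj₂ eq) = inj₂ (inj₂ (Trace-injective u v eq))

Tame-Drop : ∀ {D E r c r′} → Drop D E r c r′ → Tame D → Tame E
Tame-Drop p tame d with tame d
... | inj₁ thin   = inj₁ (Thin-Drop p thin)
... | inj₂ double = inj₂ (Double-Drop p double)

Tame-resp : ∀ {D E} → D ≈ E → Tame D → Tame E
Tame-resp e tame d with tame d
... | inj₁ thin          = inj₁ λ i j → thin (≈⇒⊇ e i) (≈⇒⊇ e j)
... | inj₂ (two , right) = inj₂ ((λ i j k → two (≈⇒⊇ e i) (≈⇒⊇ e j) (≈⇒⊇ e k)) , λ i → right (≈⇒⊇ e i))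

-- In a double column that ends the diagram the upper cell can only jump over the
-- lower one, and lowering the lower cell first splits that jump into two unit drops.
Double-jump : ∀ {D E c r′} → Double D c → Drop D E (2 + r′) c r′ → ∃[ z ] (E ≺ z × z ≺ D)
Double-jump {D} {E} {c} {r′} (two , right) p = z , Drop⇒≺ second , Drop⇒≺ first
  where
  z : Diagram
  z = relocate (suc r′ , c) (r′ , c) D
  mid : (suc r′ , c) ∈ D
  mid = full p ≤-refl ≤-refl
  first : Drop D z (suc r′) c r′
  first = relocate-Drop mid (λ lt i → <⇒≱ lt (right i)) (positive p) ≤-refl (free p)
            (λ lt lt′ → ⊥-elim (<⇒≱ lt (s≤s⁻¹ lt′)))
  second : Drop z E (2 + r′) c (suc r′)
  -- Cells carry no identity: the jump leaves the lower cell at `(suc r′ , c)`, whereas here the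
  -- upper one arrives there, and the resulting sets agree.
  second = record
    { cell      = kept first (cell p) λ ()
    ; rightmost = λ lt i → ri lt (relocate-into i)
    ; positive  = s≤s z≤n
    ; below     = ≤-refl
    ; free      = λ i → fr (relocate-into i)
    ; full      = λ lt lt′ → ⊥-elim (<⇒≱ lt (s≤s⁻¹ lt′))
    ; into      = into′
    ; landed    = kept p mid λ ()
    ; kept      = kept′
    }
    where
    ri : ∀ {d} → c < d → (2 + r′ , d) ≡ (r′ , c) ⊎ ((2 + r′ , d) ∈ D × _) → ⊥
    ri lt (inj₂ (i , _)) = rightmost p lt i
    fr : (suc r′ , c) ≡ (r′ , c) ⊎ ((suc r′ , c) ∈ D × (suc r′ , c) ≢ (suc r′ , c)) → ⊥
    fr (inj₂ (_ , n)) = n refl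
    into′ : ∀ {x} → x ∈ E → x ≡ (suc r′ , c) ⊎ (x ∈ z × x ≢ (2 + r′ , c))
    into′ {x} i with x ≟ᶜ (suc r′ , c) | into p i
    ... | yes eq | _            = inj₁ eq
    ... | no n   | inj₁ refl    = inj₂ (landed first , λ ())
    ... | no n   | inj₂ (j , m) = inj₂ (kept first j n , m)
    kept′ : ∀ {x} → x ∈ z → x ≢ (2 + r′ , c) → x ∈ E
    kept′ i n with relocate-into i
    ... | inj₁ refl    = landed p
    ... | inj₂ (j , _) = kept p j n

Tame⇒Graded : ∀ {D₀} → Tame D₀ → Graded D₀
Tame⇒Graded tame₀ {D} {E} {r} {c} {r′} D⪯D₀ p with m≤n⇒m<n∨m≡n (below p)
... | inj₂ eq = inj₁ (sym eq)
... | inj₁ 1+r′<r with ⪯-ind Tame Tame-resp Tame-Drop D⪯D₀ tame₀ c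
-- The cell jumped over and the moving cell both lie above row 1.
... | inj₁ thin with thin (full p ≤-refl 1+r′<r) (cell p)
...   | inj₁ eq          = ⊥-elim (<⇒≢ 1+r′<r eq)
...   | inj₂ (inj₁ refl) = ⊥-elim (<⇒≱ (positive p) z≤n)
...   | inj₂ (inj₂ refl) = ⊥-elim (<⇒≱ (below p) (positive p))
Tame⇒Graded tame₀ {D} {E} {r} {c} {r′} D⪯D₀ p | inj₁ 1+r′<r | inj₂ double with m≤n⇒m<n∨m≡n 1+r′<r
... | inj₂ refl  = inj₂ (Double-jump double p)
-- A longer jump would need three cells in the column: two passed over and the moving one.
... | inj₁ 2+r′<r with proj₁ double (full p ≤-refl 1+r′<r) (full p (m≤n⇒m≤1+n ≤-refl) 2+r′<r) (cell p)
...   | inj₁ eq        = ⊥-elim (<⇒≢ ≤-refl eq)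
...   | inj₂ (inj₁ eq) = ⊥-elim (<⇒≢ 1+r′<r eq)
...   | inj₂ (inj₂ eq) = ⊥-elim (<⇒≢ 2+r′<r eq)

-- Covering jumps

-- As a weight it counts the cells of column `q` in rows `t` and higher, a number that no drop
-- raises.
above : ℕ → ℕ → Cell → ℕ
above q t (i , d) with d ≟ q | t ≤? i
... | yes _ | yes _ = 1
... | _     | _     = 0

above-mono : ∀ q t {c i j} → i ≤ j → above q t (i , c) ≤ above q t (j , c)
above-mono q t {c} {i} {j} le with c ≟ q | t ≤? i | t ≤? j
... | yes _ | yes _  | yes _ = ≤-refl
... | yes _ | yes t≤ | no n  = ⊥-elim (n (≤-trans t≤ le))
... | yes _ | no _   | _     = z≤n
... | no _  | _      | _     = z≤n

above-in : ∀ {q t i} → t ≤ i → above q t (i , q) ≡ 1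
above-in {q} {t} {i} le with q ≟ q | t ≤? i
... | yes _ | yes _ = refl
... | yes _ | no n  = ⊥-elim (n le)
... | no n  | _     = ⊥-elim (n refl)

above-below : ∀ {q t i d} → i < t → above q t (i , d) ≡ 0
above-below {q} {t} {i} {d} lt with d ≟ q | t ≤? i
... | yes _ | yes le = ⊥-elim (<⇒≱ lt le)
... | yes _ | no _   = refl
... | no _  | _      = refl

above-other : ∀ {q t i d} → d ≢ q → above q t (i , d) ≡ 0
above-other {q} {t} {i} {d} n with d ≟ q | t ≤? i
... | yes eq | _ = ⊥-elim (n eq)
... | no _   | _ = refl

-- A cell of row p + 1 to the right of column m forbids splitting the jump: any other
-- first drop from D lowers a column count that the jump leaves alone.
blocked-jump-covers : ∀ {D₀ D E p m c} → Drop D E (2 + p) m p → m < c → (suc p , c) ∈ D →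
  Covers D₀ E D
blocked-jump-covers {D₀} {D} {E} {p} {m} {c} jump m<c i = Drop⇒≺ jump , between
  where
  between : ∀ z → z ⪯ D₀ → E ≺ z → z ≺ D → ⊥
  between z _ E≺z z≺D with ≺-first z≺D
  ... | F , r , q , r′ , first , z⪯F = <⇒≱ lowered (≤-trans (≤-reflexive (sym unchanged)) kept-high)
    where
    -- The threshold is the row of the first drop, so that this drop lowers the count.
    f : Cell → ℕ
    f = above q r
    lowered : weight f F < weight f D
    lowered = weight-Drop-< f (subst₂ _<_ (sym (above-below (below first))) (sym (above-in ≤-refl)) ≤-refl) first
    kept-high : weight f E ≤ weight f F
    kept-high = weight-mono f (above-mono q r) (⪯-trans (proj₁ E≺z) z⪯F)
    -- By determinism the first drop would be the jump itself, leaving no room for `z` above `E`.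
    r≢2+p : r ≢ 2 + p
    r≢2+p refl = <⇒≱ (≺⇒rowsum-< E≺z) (≤-trans (rowsum-mono z⪯F)
      (≤-reflexive (rowsum-resp (proj₂ (proj₂ (Drop-det first jump))))))
    -- In column `m` the threshold separates rows `p` and `2 + p` only if `r` is `suc p` or `2 + p`.
    -- The former is barred by the cell in column `c`.
    same : Dec (m ≡ q) → f (p , m) ≡ f (2 + p , m)
    same (no n) = trans (above-other n) (sym (above-other n))
    same (yes refl) with <-cmp r (suc p)
    ... | tri< lt _ _   = trans (above-in (s≤s⁻¹ lt)) (sym (above-in (≤-trans (s≤s⁻¹ lt) (m≤n+m p 2))))
    ... | tri≈ _ refl _ = ⊥-elim (rightmost first m<c i)
    ... | tri> _ _ gt   = trans (above-below (<-trans ≤-refl gt)) (sym (above-below (≤∧≢⇒< gt (r≢2+p ∘ sym))))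
    unchanged : weight f E ≡ weight f D
    unchanged = weight-Drop-≡ f (same (m ≟ q)) jump

-- Rank functions along unit drops

unit-covers : ∀ {D₀ D E c r} → Drop D E (suc r) c r → Covers D₀ E D
unit-covers p = Drop⇒≺ p , λ z _ E≺z z≺D →
  <⇒≱ (≺⇒rowsum-< E≺z) (s≤s⁻¹ (≤-trans (≺⇒rowsum-< z≺D) (≤-reflexive (rowsum-Drop-+ 1 p))))

-- The case `D ≈ E` allows for columns with no cell to lower and for a change of the representing
-- list.
UnitStep : Diagram → Diagram → Set
UnitStep D E = D ≈ E ⊎ (∃[ r ] ∃[ c ] Drop D E (suc r) c r)

_⇝_ : Diagram → Diagram → Set
_⇝_ = Star UnitStep

⇝⇒⪯ : ∀ {D E} → D ⇝ E → E ⪯ D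
⇝⇒⪯ ε                           = ⪯-refl ≈-refl
⇝⇒⪯ (inj₁ e ◅ s)                = ⪯-trans (⇝⇒⪯ s) (⪯-refl (≈-sym e))
⇝⇒⪯ (inj₂ (_ , _ , p) ◅ s) = ⪯-extend (⇝⇒⪯ s) p

module _ {D₀ : Diagram} {ρ : Diagram → ℕ} (rank : IsRankFunction D₀ ρ) where

  -- ρ D − ρ E = rowsum D − rowsum E, rearranged to avoid truncated subtraction.
  unit-path-balanced : ∀ {D E} → D ⪯ D₀ → D ⇝ E → ρ D + rowsum E ≡ ρ E + rowsum D
  unit-path-balanced D⪯ ε = refl
  unit-path-balanced {D} {E} D⪯ (_◅_ {j = F} (inj₁ e) s) =
    trans (cong (_+ rowsum E) (proj₁ rank D F D⪯ F⪯ e))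
      (trans (unit-path-balanced F⪯ s) (cong (ρ E +_) (sym (rowsum-resp e))))
    where
    F⪯ : F ⪯ D₀
    F⪯ = ⪯-trans (⪯-refl (≈-sym e)) D⪯
  unit-path-balanced {D} {E} D⪯ (_◅_ {j = F} (inj₂ (r , c , p)) s) = begin
    ρ D + rowsum E         ≡⟨ cong (_+ rowsum E) (proj₂ (proj₂ rank) F D F⪯ D⪯ (unit-covers p)) ⟩
    suc (ρ F + rowsum E)   ≡⟨ cong suc (unit-path-balanced F⪯ s) ⟩
    suc (ρ E + rowsum F)   ≡⟨ +-suc (ρ E) (rowsum F) ⟨
    ρ E + suc (rowsum F)   ≡⟨ cong (ρ E +_) (rowsum-Drop-+ 1 p) ⟨
    ρ E + rowsum D         ∎
    where
    open ≡-Reasoning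
    F⪯ : F ⪯ D₀
    F⪯ = ⪯-trans (Drop⇒⪯ p) D⪯

  -- Two routes lead from `D` to `A`: unit drops alone, or through `B`, the jump and `C`. Rank and
  -- row sum fall equally along unit drops, but a covering jump lowers the row sum by two and the
  -- rank by one.
  no-covering-jump : ∀ {D A B C E m p} → D ⪯ D₀ → D ⇝ A → D ⇝ B →
    Drop B C (2 + p) m p → Covers D₀ C B → C ⇝ E → E ≈ A → ⊥
  no-covering-jump {D} {A} {B} {C} {E} D⪯ D⇝A D⇝B jump cover C⇝E E≈A =
    1+n≢n (arith (ρ D) (ρ A) (ρ C) (rowsum D) (rowsum A) (rowsum C) balA balB balC)
    where
    B⪯ : B ⪯ D₀
    B⪯ = ⪯-trans (⇝⇒⪯ D⇝B) D⪯
    C⪯ : C ⪯ D₀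
    C⪯ = ⪯-trans (Drop⇒⪯ jump) B⪯
    E⪯ : E ⪯ D₀
    E⪯ = ⪯-trans (⇝⇒⪯ C⇝E) C⪯
    A⪯ : A ⪯ D₀
    A⪯ = ⪯-trans (⇝⇒⪯ D⇝A) D⪯
    balA : ρ D + rowsum A ≡ ρ A + rowsum D
    balA = unit-path-balanced D⪯ D⇝A
    balB : ρ D + (2 + rowsum C) ≡ suc (ρ C) + rowsum D
    balB = trans (cong (ρ D +_) (sym (rowsum-Drop-+ 2 jump)))
      (trans (unit-path-balanced D⪯ D⇝B) (cong (_+ rowsum D) (proj₂ (proj₂ rank) C B C⪯ B⪯ cover)))
    balC : ρ C + rowsum A ≡ ρ A + rowsum C
    balC = trans (cong (ρ C +_) (sym (rowsum-resp E≈A)))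
      (trans (unit-path-balanced C⪯ C⇝E) (cong (_+ rowsum C) (proj₁ rank E A E⪯ A⪯ E≈A)))
    open +-*-Solver
    -- The second, third and reversed first equation are added; cancelling `suc a` leaves
    -- `1 + n ≡ n`.
    arith : ∀ d a c D A C → d + A ≡ a + D → d + (2 + C) ≡ suc c + D → c + A ≡ a + C →
      suc (d + c + A + D + C) ≡ d + c + A + D + C
    arith d a c D A C e₁ e₂ e₃ = +-cancelʳ-≡ (suc a) _ _ (begin
      suc (d + c + A + D + C) + suc a
        ≡⟨ solve 6 (λ d a c D A C → con 1 :+ (d :+ c :+ A :+ D :+ C) :+ (con 1 :+ a) :=
             (d :+ (con 2 :+ C)) :+ (c :+ A) :+ (a :+ D)) refl d a c D A C ⟩
      (d + (2 + C)) + (c + A) + (a + D)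
        ≡⟨ cong₂ _+_ (cong₂ _+_ e₂ e₃) (sym e₁) ⟩
      (suc c + D) + (a + C) + (d + A)
        ≡⟨ solve 6 (λ d a c D A C → (con 1 :+ c :+ D) :+ (a :+ C) :+ (d :+ A) :=
             (d :+ c :+ A :+ D :+ C) :+ (con 1 :+ a)) refl d a c D A C ⟩
      d + c + A + D + C + suc a ∎)
      where open ≡-Reasoning

-- Sweeping part of a row down

lower : ℕ → ℕ → Cell → Cell
lower s m (r , c) with r ≟ suc s | m ≤? c
... | yes _ | yes _ = s , c
... | _     | _     = r , c

-- A plain `map` would merge a cell with one already at its target; the freeness hypothesis of
-- `sweep-path` prevents this.
sweep : ℕ → ℕ → Diagram → Diagram
sweep s m D = map (lower s m) D

lower-swept : ∀ {s m c} → m ≤ c → lower s m (suc s , c) ≡ (s , c)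
lower-swept {s} {m} {c} le with suc s ≟ suc s | m ≤? c
... | yes _ | yes _ = refl
... | yes _ | no n  = ⊥-elim (n le)
... | no n  | _     = ⊥-elim (n refl)

lower-row : ∀ {s m a c} → a ≢ suc s → lower s m (a , c) ≡ (a , c)
lower-row {s} {m} {a} {c} n with a ≟ suc s | m ≤? c
... | yes eq | _ = ⊥-elim (n eq)
... | no _   | _ = refl

lower-left : ∀ {s m a c} → c < m → lower s m (a , c) ≡ (a , c)
lower-left {s} {m} {a} {c} lt with a ≟ suc s | m ≤? c
... | yes _ | yes le = ⊥-elim (<⇒≱ lt le)
... | yes _ | no _   = refl
... | no _  | _      = refl

module _ {s m : ℕ} {D : Diagram} where

  sweep-swept : ∀ {c} → m ≤ c → (suc s , c) ∈ D → (s , c) ∈ sweep s m D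
  sweep-swept le i = subst (_∈ sweep s m D) (lower-swept le) (∈-map⁺ (lower s m) i)

  sweep-row : ∀ {a c} → a ≢ suc s → (a , c) ∈ D → (a , c) ∈ sweep s m D
  sweep-row n i = subst (_∈ sweep s m D) (lower-row n) (∈-map⁺ (lower s m) i)

  sweep-left : ∀ {a c} → c < m → (a , c) ∈ D → (a , c) ∈ sweep s m D
  sweep-left lt i = subst (_∈ sweep s m D) (lower-left lt) (∈-map⁺ (lower s m) i)

  sweep⁻-right : ∀ {a c} → m ≤ c → (a , c) ∈ sweep s m D →
    (a ≡ s × (suc s , c) ∈ D) ⊎ (a ≢ suc s × (a , c) ∈ D)
  sweep⁻-right {a} {c} le i with ∈-map⁻ (lower s m) i
  ... | (b , d) , j , eq with b ≟ suc s | m ≤? d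
  sweep⁻-right le i | _ , j , refl | yes refl | yes _ = inj₁ (refl , j)
  sweep⁻-right le i | _ , j , refl | yes refl | no n  = ⊥-elim (n le)
  sweep⁻-right le i | _ , j , refl | no n     | _     = inj₂ (n , j)

  sweep⁻-left : ∀ {a c} → c < m → (a , c) ∈ sweep s m D → (a , c) ∈ D
  sweep⁻-left {a} {c} lt i with ∈-map⁻ (lower s m) i
  ... | (b , d) , j , eq with b ≟ suc s | m ≤? d
  sweep⁻-left lt i | _ , j , refl | yes _ | yes le = ⊥-elim (<⇒≱ lt le)
  sweep⁻-left lt i | _ , j , refl | yes _ | no _   = j
  sweep⁻-left lt i | _ , j , refl | no _  | _      = j

  sweep⁻-other : ∀ {a c} → a ≢ s → (a , c) ∈ sweep s m D → (a , c) ∈ D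
  sweep⁻-other {a} {c} n i with m ≤? c
  ... | no m≰c = sweep⁻-left (≰⇒> m≰c) i
  ... | yes m≤c with sweep⁻-right m≤c i
  ...   | inj₁ (eq , _) = ⊥-elim (n eq)
  ...   | inj₂ (_ , j)  = j

column-bound : ∀ (D : Diagram) → ∃[ N ] (∀ {a c : ℕ} → (a , c) ∈ D → c < N)
column-bound [] = 0 , λ ()
column-bound ((a , c) ∷ D) with column-bound D
... | N , lt = suc c + N , λ { (here refl) → s≤s (m≤m+n c N) ; (there i) → ≤-trans (lt i) (m≤n+m N (suc c)) }

-- The two sweeps differ at most in the cell `(suc s , m)`. Once all later columns are swept, it is
-- the last cell of its row and can drop.
sweep-next : ∀ {s m D} → 1 ≤ s → ((suc s , m) ∈ D → (s , m) ∉ D) →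
  UnitStep (sweep s (suc m) D) (sweep s m D)
sweep-next {s} {m} {D} 1≤s free₀ with (suc s , m) ∈D? D
... | no n = inj₁ λ { (a , c) → ⊆ , ⊇ }
  where
  ⊆ : ∀ {a c} → (a , c) ∈ sweep s (suc m) D → (a , c) ∈ sweep s m D
  ⊆ {a} {c} i with <-cmp c m
  ... | tri< lt _ _ = sweep-left lt (sweep⁻-left (m≤n⇒m≤1+n lt) i)
  ... | tri≈ _ refl _ with a ≟ suc s
  ...   | yes refl = ⊥-elim (n (sweep⁻-left ≤-refl i))
  ...   | no a≢    = sweep-row a≢ (sweep⁻-left ≤-refl i)
  ⊆ {a} {c} i | tri> _ _ gt with sweep⁻-right gt i
  ...   | inj₁ (refl , j) = sweep-swept (<⇒≤ gt) j
  ...   | inj₂ (a≢ , j)   = sweep-row a≢ j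
  ⊇ : ∀ {a c} → (a , c) ∈ sweep s m D → (a , c) ∈ sweep s (suc m) D
  ⊇ {a} {c} i with <-cmp c m
  ... | tri< lt _ _ = sweep-left (m≤n⇒m≤1+n lt) (sweep⁻-left lt i)
  ... | tri≈ _ refl _ with sweep⁻-right ≤-refl i
  ...   | inj₁ (refl , j) = ⊥-elim (n j)
  ...   | inj₂ (a≢ , j)   = sweep-row a≢ j
  ⊇ {a} {c} i | tri> _ _ gt with sweep⁻-right (<⇒≤ gt) i
  ...   | inj₁ (refl , j) = sweep-swept gt j
  ...   | inj₂ (a≢ , j)   = sweep-row a≢ j
... | yes q = inj₂ (s , m , record
  { cell      = sweep-left ≤-refl q
  ; rightmost = λ lt i → [ (λ (eq , _) → 1+n≢n eq) , (λ (n , _) → n refl) ]′ (sweep⁻-right lt i)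
  ; positive  = 1≤s
  ; below     = ≤-refl
  ; free      = λ i → free₀ q (sweep⁻-left ≤-refl i)
  ; full      = λ lt lt′ → ⊥-elim (<⇒≱ lt (s≤s⁻¹ lt′))
  ; into      = into′
  ; landed    = sweep-swept ≤-refl q
  ; kept      = kept′
  })
  where
  into′ : ∀ {x} → x ∈ sweep s m D → x ≡ (s , m) ⊎ (x ∈ sweep s (suc m) D × x ≢ (suc s , m))
  into′ {a , c} i with <-cmp c m
  ... | tri< lt n _ = inj₂ (sweep-left (m≤n⇒m≤1+n lt) (sweep⁻-left lt i) , n ∘ cong proj₂)
  ... | tri≈ _ refl _ with sweep⁻-right ≤-refl i
  ...   | inj₁ (refl , j) = inj₁ refl
  ...   | inj₂ (a≢ , j)   = inj₂ (sweep-left ≤-refl j , a≢ ∘ cong proj₁)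
  into′ {a , c} i | tri> _ n gt with sweep⁻-right (<⇒≤ gt) i
  ...   | inj₁ (refl , j) = inj₂ (sweep-swept gt j , n ∘ cong proj₂)
  ...   | inj₂ (a≢ , j)   = inj₂ (sweep-row a≢ j , n ∘ cong proj₂)
  kept′ : ∀ {x} → x ∈ sweep s (suc m) D → x ≢ (suc s , m) → x ∈ sweep s m D
  kept′ {a , c} i x≢ with <-cmp c m
  ... | tri< lt _ _ = sweep-left lt (sweep⁻-left (m≤n⇒m≤1+n lt) i)
  ... | tri≈ _ refl _ = sweep-row (x≢ ∘ cong (_, m)) (sweep⁻-left ≤-refl i)
  ... | tri> _ _ gt with sweep⁻-right gt i
  ...   | inj₁ (refl , j) = sweep-swept (<⇒≤ gt) j
  ...   | inj₂ (a≢ , j)   = sweep-row a≢ j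

-- The cells are lowered from right to left, as only the last cell of a row may move. The induction
-- starts beyond the diagram, where sweeping is idle.
sweep-path : ∀ {s m D} → 1 ≤ s → (∀ {c} → m ≤ c → (suc s , c) ∈ D → (s , c) ∉ D) → D ⇝ sweep s m D
sweep-path {s} {m} {D} 1≤s free₀ with column-bound D
... | N , bound = go N m (m≤m+n N m) free₀
  where
  -- `n` bounds the number of columns from `m` on that can hold cells.
  go : ∀ n m → N ≤ n + m → (∀ {c} → m ≤ c → (suc s , c) ∈ D → (s , c) ∉ D) → D ⇝ sweep s m D
  go zero m N≤m _ = inj₁ (λ { (a , c) → (λ i → sweep-left (<-≤-trans (bound i) N≤m) i) , back }) ◅ ε
    where
    back : ∀ {a c} → (a , c) ∈ sweep s m D → (a , c) ∈ D
    back {a} {c} i with m ≤? c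
    ... | no m≰c = sweep⁻-left (≰⇒> m≰c) i
    ... | yes m≤c with sweep⁻-right m≤c i
    ...   | inj₁ (_ , j) = ⊥-elim (<⇒≱ (bound j) (≤-trans N≤m m≤c))
    ...   | inj₂ (_ , j) = j
  go (suc n) m N≤ free₀ =
    go n (suc m) (subst (N ≤_) (sym (+-suc n m)) N≤) (λ le → free₀ (<⇒≤ le))
      ◅◅ (sweep-next 1≤s (free₀ ≤-refl) ◅ ε)

-- Two occupied rows from a common column onwards

record Bands (D : Diagram) (m s t : ℕ) : Set where
  field
    only : ∀ {a c} → m ≤ c → (a , c) ∈ D → a ≡ s ⊎ a ≡ t
    low  : (s , m) ∈ D
    high : (t , m) ∈ D

open Bands

Bands-∉ : ∀ {D m s t a c} → Bands D m s t → m ≤ c → a ≢ s → a ≢ t → (a , c) ∉ D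
Bands-∉ b le n n′ i = [ n , n′ ]′ (only b le i)

-- Each step sweeps the upper row into a row that is empty from column `m` on. The last three
-- clauses keep track of the cells that may block and ensure that the upper row gains no others.
bring-down : ∀ k {D m s} → Bands D m s (k + suc s) → ∃[ D′ ]
  (D ⇝ D′ × Bands D′ m s (suc s) ×
   (∀ {c} → m ≤ c → (s , c) ∈ D → (s , c) ∈ D′) ×
   (∀ {c} → m ≤ c → (k + suc s , c) ∈ D → (suc s , c) ∈ D′) ×
   (∀ {c} → m ≤ c → (suc s , c) ∈ D′ → (k + suc s , c) ∈ D))
bring-down zero {D} b = D , ε , b , (λ _ i → i) , (λ _ i → i) , (λ _ i → i)
bring-down (suc k) {D} {m} {s} b
  with bring-down k {sweep t m D} {m} {s} bands
  where
  t : ℕ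
  t = k + suc s
  s<t : s < t
  s<t = m≤n+m (suc s) k
  bands : Bands (sweep t m D) m s t
  bands = record
    { only = λ le i → [ inj₂ ∘ proj₁
                      , (λ (n , j) → inj₁ ([ (λ eq → eq) , ⊥-elim ∘ n ]′ (only b le j))) ]′ (sweep⁻-right le i)
    ; low  = sweep-row (<⇒≢ (m≤n⇒m≤1+n s<t)) (low b)
    ; high = sweep-swept ≤-refl (high b)
    }
... | D′ , path , bands′ , lows , highs , highs⁻ =
  D′ , sweep-path (≤-trans (s≤s z≤n) s<t) (λ le _ → Bands-∉ b le (<⇒≢ s<t ∘ sym) (1+n≢n ∘ sym)) ◅◅ path , bands′ ,
  (λ le i → lows le (sweep-row (<⇒≢ (m≤n⇒m≤1+n s<t)) i)) ,
  (λ le i → highs le (sweep-swept le i)) ,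
  (λ le i → [ proj₂ , (λ (_ , j) → ⊥-elim (Bands-∉ b le (<⇒≢ s<t ∘ sym) (1+n≢n ∘ sym) j)) ]′
              (sweep⁻-right le (highs⁻ le i)))
  where
  s<t : s < k + suc s
  s<t = m≤n+m (suc s) k

module _ {D : Diagram} {p m : ℕ} (1≤p : 1 ≤ p) (b : Bands D m (suc p) (2 + p)) where

  -- The lower row is swept first to make room for the upper one. `shifted m` is the common end of
  -- the two chains; `shifted (suc m)` leaves column `m` in place for a jump.
  shifted : ℕ → Diagram
  shifted n = sweep (suc p) n (sweep p n D)

  private
    p∉ : ∀ {c} → m ≤ c → (p , c) ∉ D
    p∉ le = Bands-∉ b le (1+n≢n ∘ sym) (<⇒≢ (m≤n⇒m≤1+n ≤-refl))

  shifted-low : ∀ {n c} → n ≤ c → (suc p , c) ∈ D → (p , c) ∈ shifted n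
  shifted-low le i = sweep-row (<⇒≢ (m≤n⇒m≤1+n ≤-refl)) (sweep-swept le i)

  shifted-high : ∀ {n c} → n ≤ c → (2 + p , c) ∈ D → (suc p , c) ∈ shifted n
  shifted-high le i = sweep-swept le (sweep-row 1+n≢n i)

  shifted-left : ∀ {n a c} → c < n → (a , c) ∈ D → (a , c) ∈ shifted n
  shifted-left lt i = sweep-left lt (sweep-left lt i)

  shifted⁻-left : ∀ {n a c} → c < n → (a , c) ∈ shifted n → (a , c) ∈ D
  shifted⁻-left lt i = sweep⁻-left lt (sweep⁻-left lt i)

  shifted⁻-right : ∀ {n a c} → m ≤ n → n ≤ c → (a , c) ∈ shifted n →
    (a ≡ p × (suc p , c) ∈ D) ⊎ (a ≡ suc p × (2 + p , c) ∈ D)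
  shifted⁻-right {n} {a} {c} m≤n le i with sweep⁻-right le i
  ... | inj₁ (eq , j) = inj₂ (eq , sweep⁻-other (<⇒≢ (m≤n⇒m≤1+n ≤-refl) ∘ sym) j)
  ... | inj₂ (a≢ , j) with sweep⁻-right le j
  ...   | inj₁ q = inj₁ q
  ...   | inj₂ (a≢′ , k) = ⊥-elim (Bands-∉ b (≤-trans m≤n le) a≢′ a≢ k)

  shifted-path : ∀ {n} → m ≤ n → D ⇝ shifted n
  shifted-path m≤n =
    sweep-path 1≤p (λ le _ → p∉ (≤-trans m≤n le)) ◅◅
    sweep-path (s≤s z≤n) (λ le _ i →
      [ (λ (eq , _) → 1+n≢n eq) , (λ (n , _) → n refl) ]′ (sweep⁻-right le i))

  -- Lowering both cells of column `m` by one gives the same set as the jump of the upper over the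
  -- lower. The columns right of `m` have already left row `2 + p`.
  shifted-jump : Drop (shifted (suc m)) (shifted m) (2 + p) m p
  shifted-jump = record
    { cell      = shifted-left ≤-refl (high b)
    ; rightmost = λ lt i → [ (λ (eq , _) → <⇒≢ (m≤n⇒m≤1+n ≤-refl) (sym eq)) , (λ (eq , _) → 1+n≢n eq) ]′
                             (shifted⁻-right (n≤1+n m) lt i)
    ; positive  = 1≤p
    ; below     = m≤n⇒m≤1+n ≤-refl
    ; free      = λ i → p∉ ≤-refl (shifted⁻-left ≤-refl i)
    ; full      = λ lt lt′ → subst (λ k → (k , m) ∈ shifted (suc m)) (≤-antisym lt (s≤s⁻¹ lt′))
                               (shifted-left ≤-refl (low b))
    ; into      = into′
    ; landed    = shifted-low ≤-refl (low b)
    ; kept      = kept′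
    }
    where
    into′ : ∀ {x} → x ∈ shifted m → x ≡ (p , m) ⊎ (x ∈ shifted (suc m) × x ≢ (2 + p , m))
    into′ {a , c} i with <-cmp c m
    ... | tri< lt n _ = inj₂ (shifted-left (m≤n⇒m≤1+n lt) (shifted⁻-left lt i) , n ∘ cong proj₂)
    ... | tri≈ _ refl _ with shifted⁻-right ≤-refl ≤-refl i
    ...   | inj₁ (refl , j) = inj₁ refl
    ...   | inj₂ (refl , j) = inj₂ (shifted-left ≤-refl (low b) , λ ())
    into′ {a , c} i | tri> _ n gt with shifted⁻-right ≤-refl (<⇒≤ gt) i
    ...   | inj₁ (refl , j) = inj₂ (shifted-low gt j , n ∘ cong proj₂)
    ...   | inj₂ (refl , j) = inj₂ (shifted-high gt j , n ∘ cong proj₂)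
    kept′ : ∀ {x} → x ∈ shifted (suc m) → x ≢ (2 + p , m) → x ∈ shifted m
    kept′ {a , c} i x≢ with <-cmp c m
    ... | tri< lt _ _ = shifted-left lt (shifted⁻-left (m≤n⇒m≤1+n lt) i)
    ... | tri≈ _ refl _ with only b ≤-refl (shifted⁻-left ≤-refl i)
    ...   | inj₁ refl = shifted-high ≤-refl (high b)
    ...   | inj₂ refl = ⊥-elim (x≢ refl)
    kept′ {a , c} i x≢ | tri> _ _ gt with shifted⁻-right (n≤1+n m) gt i
    ...   | inj₁ (refl , j) = shifted-low (<⇒≤ gt) j
    ...   | inj₂ (refl , j) = shifted-high (<⇒≤ gt) j

  -- In `shifted (suc m)` the cell of column `c` has come down to row `suc p`, where it blocks. The
  -- jump then ends in `shifted m`, which unit drops also reach.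
  high-blocker-unranked : ∀ {c} → m < c → (2 + p , c) ∈ D →
    ∀ {D₀ ρ} → IsRankFunction D₀ ρ → D ⪯ D₀ → ⊥
  high-blocker-unranked m<c i rank D⪯ =
    no-covering-jump rank D⪯ (shifted-path ≤-refl) (shifted-path (n≤1+n m)) shifted-jump
      (blocked-jump-covers shifted-jump m<c (shifted-high m<c i)) ε ≈-refl

  module _ (none : ∀ {c} → m < c → (2 + p , c) ∉ D) where

    jumped : Diagram
    jumped = relocate (2 + p , m) (p , m) D

    jump : Drop D jumped (2 + p) m p
    jump = relocate-Drop (high b) none 1≤p (m≤n⇒m≤1+n ≤-refl) (p∉ ≤-refl)
      (λ lt lt′ → subst (λ k → (k , m) ∈ D) (≤-antisym lt (s≤s⁻¹ lt′)) (low b))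

    jumped-away : ∀ {a c} → c ≢ m → (a , c) ∈ jumped → (a , c) ∈ D
    jumped-away n i with relocate-into i
    ... | inj₁ refl    = ⊥-elim (n refl)
    ... | inj₂ (j , _) = j

    jumped-kept : ∀ {a c} → c ≢ m → (a , c) ∈ D → (a , c) ∈ jumped
    jumped-kept n i = kept jump i (n ∘ cong proj₂)

    jumped-path : jumped ⇝ sweep p (suc m) jumped
    jumped-path = sweep-path 1≤p (λ lt _ i → p∉ (<⇒≤ lt) (jumped-away (<⇒≢ lt ∘ sym) i))

    -- The jump has already put column `m` in its final state, hence the sweep from `suc m`. Further
    -- right only row `suc p` is occupied, so one sweep suffices.
    jumped-swept : sweep p (suc m) jumped ≈ shifted m
    jumped-swept _ = ⊆ , ⊇
      where
      ⊆ : ∀ {x} → x ∈ sweep p (suc m) jumped → x ∈ shifted m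
      ⊆ {a , c} i with <-cmp c m
      ... | tri< lt n _ = shifted-left lt (jumped-away n (sweep⁻-left (m≤n⇒m≤1+n lt) i))
      ... | tri≈ _ refl _ with relocate-into (sweep⁻-left ≤-refl i)
      ...   | inj₁ refl = shifted-low ≤-refl (low b)
      ...   | inj₂ (j , x≢) with only b ≤-refl j
      ...     | inj₁ refl = shifted-high ≤-refl (high b)
      ...     | inj₂ refl = ⊥-elim (x≢ refl)
      ⊆ {a , c} i | tri> _ n gt with sweep⁻-right gt i
      ...   | inj₁ (refl , j) = shifted-low (<⇒≤ gt) (jumped-away n j)
      ...   | inj₂ (a≢ , j) with only b (<⇒≤ gt) (jumped-away n j)
      ...     | inj₁ eq   = ⊥-elim (a≢ eq)
      ...     | inj₂ refl = ⊥-elim (none gt (jumped-away n j))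
      ⊇ : ∀ {x} → x ∈ shifted m → x ∈ sweep p (suc m) jumped
      ⊇ {a , c} i with <-cmp c m
      ... | tri< lt n _ = sweep-left (m≤n⇒m≤1+n lt) (jumped-kept n (shifted⁻-left lt i))
      ... | tri≈ _ refl _ with shifted⁻-right ≤-refl ≤-refl i
      ...   | inj₁ (refl , _) = sweep-left ≤-refl (landed jump)
      ...   | inj₂ (refl , _) = sweep-left ≤-refl (kept jump (low b) λ ())
      ⊇ {a , c} i | tri> _ n gt with shifted⁻-right ≤-refl (<⇒≤ gt) i
      ...   | inj₁ (refl , j) = sweep-swept gt (jumped-kept n j)
      ...   | inj₂ (refl , j) = ⊥-elim (none gt j)

    -- The blocker stands in row `suc p` from the outset, so the jump is made in `D` itself and the
    -- blocker is swept down afterwards.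
    low-blocker-unranked : ∀ {c} → m < c → (suc p , c) ∈ D →
      ∀ {D₀ ρ} → IsRankFunction D₀ ρ → D ⪯ D₀ → ⊥
    low-blocker-unranked m<c i rank D⪯ =
      no-covering-jump rank D⪯ (shifted-path ≤-refl) ε jump
        (blocked-jump-covers jump m<c i) jumped-path jumped-swept

-- Two-row diagrams

module _ {D₀ : Diagram} {r₁ r₂ : ℕ} (two : TwoRow D₀ r₁ r₂) where

  r₁<r₂ : r₁ < r₂
  r₁<r₂ = proj₁ (proj₂ two)

  rows : ∀ {r c} → (r , c) ∈ D₀ → r ≡ r₁ ⊎ r ≡ r₂
  rows = proj₂ (proj₂ (proj₂ (proj₂ two))) _ _

  one-row⇒Thin : ∀ {c} → ¬ InColBoth D₀ r₁ r₂ c → Thin D₀ c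
  one-row⇒Thin n i j with rows i | rows j
  ... | inj₁ refl | inj₁ refl = inj₁ refl
  ... | inj₁ refl | inj₂ refl = ⊥-elim (n (i , j))
  ... | inj₂ refl | inj₁ refl = ⊥-elim (n (j , i))
  ... | inj₂ refl | inj₂ refl = inj₁ refl

  bottom⇒Tame : r₁ ≡ 1 → Tame D₀
  bottom⇒Tame eq c = inj₁ thin
    where
    thin : Thin D₀ c
    thin i j with rows i | rows j
    ... | inj₁ e    | _         = inj₂ (inj₁ (trans e eq))
    ... | inj₂ _    | inj₁ e    = inj₂ (inj₂ (trans e eq))
    ... | inj₂ refl | inj₂ refl = inj₁ refl

  inColBoth? : ∀ c → Dec (InColBoth D₀ r₁ r₂ c)
  inColBoth? c with (r₁ , c) ∈D? D₀ | (r₂ , c) ∈D? D₀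
  ... | yes i | yes j = yes (i , j)
  ... | no n  | _     = no (n ∘ proj₁)
  ... | yes _ | no n  = no (n ∘ proj₂)

  at-most-two : ∀ {c i j k} → (i , c) ∈ D₀ → (j , c) ∈ D₀ → (k , c) ∈ D₀ → i ≡ j ⊎ i ≡ k ⊎ j ≡ k
  at-most-two i j k with rows i | rows j | rows k
  ... | inj₁ refl | inj₁ refl | _         = inj₁ refl
  ... | inj₂ refl | inj₂ refl | _         = inj₁ refl
  ... | inj₁ refl | inj₂ refl | inj₁ refl = inj₂ (inj₁ refl)
  ... | inj₁ refl | inj₂ refl | inj₂ refl = inj₂ (inj₂ refl)
  ... | inj₂ refl | inj₁ refl | inj₁ refl = inj₂ (inj₂ refl)
  ... | inj₂ refl | inj₁ refl | inj₂ refl = inj₂ (inj₁ refl)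

  last-common⇒Tame :
    (∀ c → InColRight D₀ r₁ r₂ r₁ r₂ c → ⊥) → (∀ c → InColRight D₀ r₁ r₂ r₂ r₁ c → ⊥) →
    (∀ c c′ → InColBoth D₀ r₁ r₂ c → InColBoth D₀ r₁ r₂ c′ → c ≡ c′) → Tame D₀
  last-common⇒Tame no₁ no₂ unique c with inColBoth? c
  ... | no n  = inj₁ (one-row⇒Thin n)
  ... | yes q = inj₂ (at-most-two , λ i → ≮⇒≥ λ c<d → beyond c<d i)
    where
    common : ∀ {d} → c < d → ∀ m → InColBoth D₀ r₁ r₂ m → m < d
    common c<d m q′ = subst (_< _) (unique c m q q′) c<d
    -- As `c` is the only common column, a cell right of it lies in just one of the rows, which
    -- `no₁` and `no₂` exclude.
    beyond : ∀ {i d} → c < d → (i , d) ∉ D₀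
    beyond {d = d} c<d i with rows i
    ... | inj₁ refl = no₁ d ((i , λ j → <⇒≢ c<d (unique c d q (i , j))) , (c , q) , common c<d)
    ... | inj₂ refl = no₂ d ((i , λ j → <⇒≢ c<d (unique c d q (j , i))) , (c , q) , common c<d)

  -- `bring-down` makes the two rows adjacent. Cells of row `r₂` are excluded first, because the
  -- argument for a low blocker assumes none right of `m` in the upper row.
  Ranked⇒last : Ranked D₀ → 1 < r₁ → ∀ {m} → InColBoth D₀ r₁ r₂ m → ∀ {i c} → m < c → (i , c) ∉ D₀
  -- The match turns `r₁` into `suc p` with `p` positive, so there is a row to drop into.
  Ranked⇒last (ρ , rank) (s≤s 1≤p) {m} (i₁ , i₂) = beyond
    where
    -- The number of rows strictly between `r₁` and `r₂`.
    k : ℕ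
    k = r₂ ∸ suc r₁
    r₂≡ : k + suc r₁ ≡ r₂
    r₂≡ = m∸n+n≡m r₁<r₂
    bands : Bands D₀ m r₁ (k + suc r₁)
    bands = record
      { only = λ _ i → [ inj₁ , (λ e → inj₂ (trans e (sym r₂≡))) ]′ (rows i)
      ; low  = i₁
      ; high = subst (λ t → (t , m) ∈ D₀) (sym r₂≡) i₂
      }
    not-high : ∀ {c} → m < c → (r₂ , c) ∉ D₀
    not-high {c} lt i with bring-down k bands
    ... | D , path , b , _ , highs , _ = high-blocker-unranked 1≤p b lt
      (highs (<⇒≤ lt) (subst (λ t → (t , c) ∈ D₀) (sym r₂≡) i)) rank (⇝⇒⪯ path)
    not-low : ∀ {c} → m < c → (r₁ , c) ∉ D₀
    not-low {c} lt i with bring-down k bands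
    ... | D , path , b , lows , _ , highs⁻ = low-blocker-unranked 1≤p b
      (λ {d} lt′ j → not-high lt′ (subst (λ t → (t , d) ∈ D₀) r₂≡ (highs⁻ (<⇒≤ lt′) j)))
      lt (lows (<⇒≤ lt) i) rank (⇝⇒⪯ path)
    beyond : ∀ {i c} → m < c → (i , c) ∉ D₀
    beyond lt i with rows i
    ... | inj₁ refl = not-low lt i
    ... | inj₂ refl = not-high lt i

theorem5p9 : (D0 : Diagram) (r1 r2 : ℕ) → TwoRow D0 r1 r2 →
    (Ranked D0 ⇔
    (r1 ≡ 1 ⊎
    (1 < r1 ×
    (∀ c → InColRight D0 r1 r2 r1 r2 c → ⊥) ×
    (∀ c → InColRight D0 r1 r2 r2 r1 c → ⊥) ×
    (∀ c c′ → InColBoth D0 r1 r2 c → InColBoth D0 r1 r2 c′ → c ≡ c′)))) ×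
    (Ranked D0 → ∃[ b ] (IsB D0 b × IsRankFunction D0 (λ D → rowsum D ∸ b)))
theorem5p9 D0 r1 r2 two =
  -- An arbitrary rank function gives the condition, and the condition gives the explicit rank
  -- function.
  mk⇔ necessary (λ h → let b , _ , rank = sufficient h in (λ D → rowsum D ∸ b) , rank) , sufficient ∘ necessary
  where
  Condition : Set
  Condition = r1 ≡ 1 ⊎
    (1 < r1 ×
    (∀ c → InColRight D0 r1 r2 r1 r2 c → ⊥) ×
    (∀ c → InColRight D0 r1 r2 r2 r1 c → ⊥) ×
    (∀ c c′ → InColBoth D0 r1 r2 c → InColBoth D0 r1 r2 c′ → c ≡ c′))

  sufficient : Condition → ∃[ b ] (IsB D0 b × IsRankFunction D0 (λ D → rowsum D ∸ b))
  sufficient h = Graded⇒IsRankFunction (Tame⇒Graded (tame h))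
    where
    tame : Condition → Tame D0
    tame (inj₁ eq) = bottom⇒Tame two eq
    tame (inj₂ (_ , no₁ , no₂ , unique)) = last-common⇒Tame two no₁ no₂ unique

  necessary : Ranked D0 → Condition
  -- `IsDiagram`, applied to a cell of row `r1`, gives `1 ≤ r1`.
  necessary ranked with m≤n⇒m<n∨m≡n (proj₁ (All.lookup (proj₁ two) (proj₂ (proj₁ (proj₂ (proj₂ two))))))
  ... | inj₂ eq   = inj₁ (sym eq)
  ... | inj₁ 1<r1 = inj₂ (1<r1 , right , right , unique)
    where
    last : ∀ {m} → InColBoth D0 r1 r2 m → ∀ {i c} → m < c → (i , c) ∉ D0
    last = Ranked⇒last two ranked 1<r1
    right : ∀ {ri rj} c → InColRight D0 r1 r2 ri rj c → ⊥
    right c ((i , _) , (m , q) , lt) = last q (lt m q) i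
    unique : ∀ c c′ → InColBoth D0 r1 r2 c → InColBoth D0 r1 r2 c′ → c ≡ c′
    -- Of two common columns, the right one would put a cell beyond the left one.
    unique c c′ q q′ with <-cmp c c′
    ... | tri< lt _ _ = ⊥-elim (last q lt (proj₁ q′))
    ... | tri≈ _ eq _ = eq
    ... | tri> _ _ gt = ⊥-elim (last q′ gt (proj₁ q))
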